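{- If $D$ is a strong digraph, then at least one of the following holds: (a) $D$ has a $2$-partition $(V_1,V_2)$ such that every vertex of $V_1$ has an out-neighbour in $V_2$ and every vertex of $V_2$ has an in-neighbour in $V_1$; (b) $D$ consists of a single vertex; (c) $D$ has an arc $xy$ with $d^+_D(x)=d^-_D(y)=1$.
   Context: A digraph is strong if for every ordered pair $u,v$ of distinct vertices there is a directed $(u,v)$-path. Digraphs have no loops or parallel arcs. -}

module Defs where

open import Data.Nat using (ℕ; zero; suc)
open import Data.Bool using (Bool; true; false; T; if_then_else_)
open import Data.Fin using (Fin)
open import Data.List using (List; []; _∷_; map; allFin)
open import Data.Nat.ListAction using (sum)
open import Data.List.Relation.Unary.Unique.Propositional using (Unique)
open import Data.Product using (Σ; ∃; ∃-syntax; _×_; _,_)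
open import Relation.Nullary using (¬_)
open import Relation.Binary.PropositionalEquality using (_≡_; _≢_)

-- A finite digraph on vertex set Fin n.  The arc set is given by a
-- Boolean adjacency function, so there are no parallel arcs; loops are
-- excluded explicitly.
record Digraph : Set where
  field
    n        : ℕ
    arc      : Fin n → Fin n → Bool
    loopless : (v : Fin n) → arc v v ≡ false
open Digraph public

Vertex : Digraph → Set
Vertex D = Fin (n D)

Arc : (D : Digraph) → Vertex D → Vertex D → Set
Arc D u v = T (arc D u v)

outdeg : (D : Digraph) → Vertex D → ℕ
outdeg D v = sum (map (λ w → if arc D v w then 1 else 0) (allFin (n D)))

indeg : (D : Digraph) → Vertex D → ℕ
indeg D v = sum (map (λ w → if arc D w v then 1 else 0) (allFin (n D)))

data Walk (D : Digraph) : Vertex D → Vertex D → Set where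
  here : (u : Vertex D) → Walk D u u
  step : {u w v : Vertex D} → Arc D u w → Walk D w v → Walk D u v

walkVertices : {D : Digraph} {u v : Vertex D} → Walk D u v → List (Vertex D)
walkVertices (here u) = u ∷ []
walkVertices (step {u = u} _ p) = u ∷ walkVertices p

Path : (D : Digraph) → Vertex D → Vertex D → Set
Path D u v = Σ (Walk D u v) (λ p → Unique (walkVertices p))

Strong : Digraph → Set
Strong D = (u v : Vertex D) → u ≢ v → Path D u v

-- A 2-partition (V₁,V₂): V₁ = {v | side v ≡ true}, V₂ = {v | side v ≡ false},
-- both nonempty.
IsTwoPartition : (D : Digraph) → (Vertex D → Bool) → Set
IsTwoPartition D side = (∃[ v ] side v ≡ true) × (∃[ v ] side v ≡ false)

GoodPartition : Digraph → Set
GoodPartition D =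
  Σ (Vertex D → Bool) λ side →
    IsTwoPartition D side
    × ((v : Vertex D) → side v ≡ true  → ∃[ w ] (side w ≡ false × Arc D v w))
    × ((v : Vertex D) → side v ≡ false → ∃[ w ] (side w ≡ true  × Arc D w v))

{-# OPTIONS --safe #-}

-- Call a partial 2-colouring good if every true vertex has a false out-neighbour and every
-- false vertex a true in-neighbour.  If all uncoloured vertices can be reached from true
-- vertices through uncoloured ones, it extends to a good colouring of D: in an out-forest
-- grown from the true vertices, colour a vertex true iff it has a false child.
--
-- Let H be a strong proper subset, and P a shortest path that leaves H and returns to it.
-- H ∪ P is again strong, so enlarging H we may assume V(D) = H ∪ P.  Number the k vertices
-- of P by their distance to H, so that all arcs go down by at most one level and H enters P
-- only at the top.  If k is odd, alternating colours on P extend.  If k is even, so do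
-- alternating colours along an even cycle closed by an upward arc; hence upward arcs
-- preserve parity.  If no arc from level 2t+2 to level 2t+1 satisfies (c), then each t has
-- an upward arc out of level 2t+2 or one into level 2t+1.  The top t fails the former and
-- t = 0 the latter, so for some t there are upward arcs out of level 2t+2 and into level
-- 2t+3, and these crossing arcs again yield an extendable colouring.

module Submission where

open import Defs
open import Data.Bool using (Bool; true; false; not; if_then_else_)
open import Data.Bool.Properties using (T?; T-≡; not-injective; ¬-not)
import Data.Bool.Properties as Bool
open import Data.Fin using (Fin; zero; suc)
open import Data.Fin.Properties using (any?)
import Data.Fin.Properties as Fin
open import Data.Fin.Subset using (_⊃_)
open import Data.Fin.Subset.Induction using (⊃-wellFounded)
open import Data.List using (tabulate)
open import Data.List.Properties using (map-tabulate)
open import Data.Maybe using (Maybe; just; nothing; is-just)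
open import Data.Maybe.Properties using (just-injective)
open import Data.Nat using (ℕ; zero; suc; pred; _+_; _*_; _∸_; _≤_; _<_; _≥_; z≤n; s≤s; s≤s⁻¹; _≤?_; _<?_; _≟_)
open import Data.Nat.ListAction using (sum)
open import Data.Nat.Properties
open import Data.Product using (∃-syntax; _×_; _,_; proj₁; proj₂)
open import Data.Sum using (_⊎_; inj₁; inj₂; map₂)
import Data.Vec as Vec
open import Data.Vec.Properties using (lookup∘tabulate; []=⇒lookup; lookup⇒[]=)
open import Function using (_∘_; id; _on_; Equivalence)
open import Induction.WellFounded using (WellFounded; Acc; acc; module Subrelation)
import Relation.Binary.Construct.On as On
open import Relation.Binary.PropositionalEquality using (_≡_; _≢_; refl; sym; trans; cong; subst)
open import Relation.Nullary using (¬_; Dec; yes; no; does; contradiction; _×-dec_; _⊎-dec_)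
open import Relation.Nullary.Decidable using (dec-true; dec-false)
open import Relation.Unary using (Decidable)

-- Booleans, least witnesses and parity.

true≢false : ∀ {b} → b ≡ true → b ≢ false
true≢false refl ()

does-true : ∀ {a} {A : Set a} (d : Dec A) → does d ≡ true → A
does-true (yes a) _ = a

least : ∀ {P : ℕ → Set} → Decidable P → ∀ m → P m → ∃[ l ] (P l × (∀ {j} → P j → l ≤ j))
least P? m pm with P? 0
... | yes p₀ = 0 , p₀ , λ _ → z≤n
least P? zero    pm | no ¬p₀ = contradiction pm ¬p₀
least {P} P? (suc m) pm | no ¬p₀ with least (P? ∘ suc) m pm
... | l , pl , min = suc l , pl , minimal _
  where
  minimal : ∀ j → P j → suc l ≤ j
  minimal zero    p = contradiction p ¬p₀
  minimal (suc j) p = s≤s (min p)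

odd : ℕ → Bool
odd zero    = false
odd (suc m) = not (odd m)

odd-2* : ∀ t → odd (2 * t) ≡ false
odd-2* zero    = refl
odd-2* (suc t) rewrite +-suc t (t + 0) | odd-2* t = refl

even⇒2* : ∀ m → odd m ≡ false → ∃[ t ] (m ≡ 2 * t)
even⇒2* zero          _ = 0 , refl
even⇒2* (suc (suc m)) e with even⇒2* m (trans (sym (Bool.not-involutive (odd m))) e)
... | t , refl = suc t , sym (*-suc 2 t)

-- Degrees as sums of indicators.

indicator : Bool → ℕ
indicator b = if b then 1 else 0

sum-indicator-none : ∀ {m} (f : Fin m → Bool) → (∀ i → f i ≡ false) →
  sum (tabulate (indicator ∘ f)) ≡ 0
sum-indicator-none {zero}  f none = refl
sum-indicator-none {suc m} f none rewrite none zero = sum-indicator-none (f ∘ suc) (none ∘ suc)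

sum-indicator-unique : ∀ {m} (f : Fin m → Bool) y → f y ≡ true → (∀ i → f i ≡ true → i ≡ y) →
  sum (tabulate (indicator ∘ f)) ≡ 1
sum-indicator-unique f zero fy uniq rewrite fy = cong suc (sum-indicator-none (f ∘ suc) none)
  where
  none : ∀ i → f (suc i) ≡ false
  none i with f (suc i) in eq
  ... | false = refl
  ... | true with () ← uniq (suc i) eq
sum-indicator-unique f (suc y) fy uniq with f zero in eq
... | true with () ← uniq zero eq
... | false = sum-indicator-unique (f ∘ suc) y fy (λ i e → Fin.suc-injective (uniq (suc i) e))

-- Strict enlargement of finite sets.

_⊐_ : ∀ {m} → (Fin m → Bool) → (Fin m → Bool) → Set
Z ⊐ Y = (∀ v → Y v ≡ true → Z v ≡ true) × ∃[ v ] (Z v ≡ true × Y v ≡ false)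

-- The larger set counts as the smaller element, so recursion may enlarge a vertex set; it ends
-- because the vertex set is finite.
⊐-wellFounded : ∀ {m} → WellFounded (_⊐_ {m})
⊐-wellFounded = Subrelation.wellFounded toSubset (On.wellFounded Vec.tabulate ⊃-wellFounded)
  where
  toSubset : ∀ {m} {Z Y : Fin m → Bool} → Z ⊐ Y → (_⊃_ on Vec.tabulate) Z Y
  toSubset {Z = Z} {Y} (Y⊆Z , v , Zv , ¬Yv) =
    (λ {w} w∈Y → lookup⇒[]= w _ (trans (lookup∘tabulate Z w)
        (Y⊆Z w (trans (sym (lookup∘tabulate Y w)) ([]=⇒lookup w∈Y))))) ,
    v , lookup⇒[]= v _ (trans (lookup∘tabulate Z v) Zv) ,
    λ v∈Y → true≢false (trans (sym (lookup∘tabulate Y v)) ([]=⇒lookup v∈Y)) ¬Yv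

module _ (D : Digraph) where

  private
    V : Set
    V = Vertex D

  LonelyArc : Set
  LonelyArc = ∃[ x ] ∃[ y ] (Arc D x y × outdeg D x ≡ 1 × indeg D y ≡ 1)

  no-loop : ∀ {v} → ¬ Arc D v v
  no-loop {v} a = true≢false (Equivalence.to T-≡ a) (loopless D v)

  outdeg≡1 : ∀ {x y} → Arc D x y → (∀ w → Arc D x w → w ≡ y) → outdeg D x ≡ 1
  outdeg≡1 {x} {y} a uniq = trans (cong sum (map-tabulate id (indicator ∘ arc D x)))
    (sum-indicator-unique (arc D x) y (Equivalence.to T-≡ a) (λ w e → uniq w (Equivalence.from T-≡ e)))

  indeg≡1 : ∀ {x y} → Arc D x y → (∀ w → Arc D w y → w ≡ x) → indeg D y ≡ 1
  indeg≡1 {x} {y} a uniq = trans (cong sum (map-tabulate id (λ w → indicator (arc D w y))))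
    (sum-indicator-unique (λ w → arc D w y) x (Equivalence.to T-≡ a) (λ w e → uniq w (Equivalence.from T-≡ e)))

  -- Good partial colourings and their extension.

  record Good (s : V → Maybe Bool) : Set where
    field
      out : ∀ v → s v ≡ just true  → ∃[ w ] (s w ≡ just false × Arc D v w)
      inn : ∀ v → s v ≡ just false → ∃[ w ] (s w ≡ just true × Arc D w v)

  good-total : ∀ {s} → Good s → (∀ v → s v ≢ nothing) → V → GoodPartition D
  good-total {s} good total v₀ = side , nonempty (side v₀) refl , out′ , inn′
    where
    side : V → Bool
    side v with s v
    ... | just b  = b
    -- Arbitrary value; `total` rules this case out.
    ... | nothing = false

    side⇒s : ∀ {v b} → side v ≡ b → s v ≡ just b
    side⇒s {v} e with s v | total v
    ... | just _  | _ = cong just e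
    ... | nothing | t = contradiction refl t

    s⇒side : ∀ {v b} → s v ≡ just b → side v ≡ b
    s⇒side {v} e with s v
    ... | just _ = just-injective e

    out′ : ∀ v → side v ≡ true → ∃[ w ] (side w ≡ false × Arc D v w)
    out′ v e with Good.out good v (side⇒s e)
    ... | w , e′ , a = w , s⇒side e′ , a

    inn′ : ∀ v → side v ≡ false → ∃[ w ] (side w ≡ true × Arc D w v)
    inn′ v e with Good.inn good v (side⇒s e)
    ... | w , e′ , a = w , s⇒side e′ , a

    -- The witness of `v₀` has the other colour, so one vertex makes both classes nonempty.
    nonempty : ∀ b → side v₀ ≡ b → IsTwoPartition D side
    nonempty true  e with out′ v₀ e
    ... | w , e′ , _ = (v₀ , e) , w , e′
    nonempty false e with inn′ v₀ e
    ... | w , e′ , _ = (w , e′) , v₀ , e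

  colour-arc : (V → Maybe Bool) → V → V → V → Maybe Bool
  colour-arc s u v w with w Fin.≟ v | w Fin.≟ u
  ... | yes _ | _     = just false
  ... | no  _ | yes _ = just true
  ... | no  _ | no  _ = s w

  -- The ends of the arc are witnesses for each other. Since `u` is not false and `v` is uncoloured
  -- beforehand, no existing colour changes and all earlier witnesses survive.
  module ColourArc {s : V → Maybe Bool} {u v : V} (u≢v : u ≢ v) (a : Arc D u v)
                   (su : s u ≢ just false) (sv : s v ≡ nothing) where
    private s′ = colour-arc s u v

    at-v : s′ v ≡ just false
    at-v with v Fin.≟ v | v Fin.≟ u
    ... | yes _ | _ = refl
    ... | no ¬p | _ = contradiction refl ¬p

    at-u : s′ u ≡ just true
    at-u with u Fin.≟ v | u Fin.≟ u
    ... | yes p | _     = contradiction p u≢v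
    ... | no _  | yes _ = refl
    ... | no _  | no ¬p = contradiction refl ¬p

    keeps : ∀ {w b} → s w ≡ just b → s′ w ≡ just b
    keeps {w} {b} e with w Fin.≟ v | w Fin.≟ u
    ... | yes refl | _ with () ← trans (sym sv) e
    keeps {b = true}  e | no _ | yes refl = refl
    keeps {b = false} e | no _ | yes refl = contradiction e su
    ... | no _ | no _ = e

    defined : ∀ {w} → s w ≢ nothing → s′ w ≢ nothing
    defined {w} d e with s w in eq
    ... | nothing = d refl
    ... | just b with () ← trans (sym e) (keeps eq)

    not-false : ∀ {w} → w ≢ v → s w ≢ just false → s′ w ≢ just false
    not-false {w} w≢v sw with w Fin.≟ v | w Fin.≟ u
    ... | yes p | _     = contradiction p w≢v
    ... | no _  | yes _ = λ ()
    ... | no _  | no _  = sw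

    good : Good s → Good s′
    good g = record { out = out′ ; inn = inn′ }
      where
      out′ : ∀ w → s′ w ≡ just true → ∃[ z ] (s′ z ≡ just false × Arc D w z)
      out′ w e with w Fin.≟ v | w Fin.≟ u
      ... | no _ | yes refl = v , at-v , a
      ... | no _ | no _ with Good.out g w e
      ...   | z , ez , az = z , keeps ez , az

      inn′ : ∀ w → s′ w ≡ just false → ∃[ z ] (s′ z ≡ just true × Arc D z w)
      inn′ w e with w Fin.≟ v | w Fin.≟ u
      ... | yes refl | _ = u , at-u , a
      ... | no _ | no _ with Good.inn g w e
      ...   | z , ez , az = z , keeps ez , az

  -- With `Y` the set of vertices discovered so far, `u` is true or uncoloured, so it may serve as
  -- the parent of `v` in the out-forest.
  Escape : (V → Maybe Bool) → (V → Bool) → Set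
  Escape s Y = ∃[ u ] ∃[ v ] (Arc D u v × Y u ≡ true × Y v ≡ false × s u ≢ just false)

  -- The recursion enlarges Y first and colours afterwards, so vertices are coloured in
  -- the reverse order of their discovery.
  module _ {s : V → Maybe Bool} (good : Good s)
           (escape : ∀ Y → (∀ v → s v ≢ nothing → Y v ≡ true) → ∀ v → Y v ≡ false → Escape s Y) where

    -- Vertices of `Y` need not be coloured yet. The field `not-false` keeps them available as true
    -- tails of the arcs by which earlier stages discovered their vertices.
    record Extension (Y : V → Bool) : Set where
      field
        s′        : V → Maybe Bool
        good′     : Good s′
        covers    : ∀ v → Y v ≡ false → s′ v ≢ nothing
        defined   : ∀ v → s v ≢ nothing → s′ v ≢ nothing
        not-false : ∀ v → Y v ≡ true → s v ≢ just false → s′ v ≢ just false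

    extension : ∀ Y → Acc _⊐_ Y → (∀ v → s v ≢ nothing → Y v ≡ true) → Extension Y
    extension Y (acc rec) s⊆Y with any? (λ v → Y v Bool.≟ false)
    ... | no full = record
      { s′ = s ; good′ = good ; covers = λ v e → contradiction (v , e) full
      ; defined = λ _ d → d ; not-false = λ _ _ d → d }
    ... | yes (v₀ , Yv₀) with escape Y s⊆Y v₀ Yv₀
    ...   | u , v , a , Yu , Yv , su = result
      where
      Y⁺ : V → Bool
      Y⁺ w = does (w Fin.≟ v ⊎-dec Y w Bool.≟ true)

      Y⊆Y⁺ : ∀ w → Y w ≡ true → Y⁺ w ≡ true
      Y⊆Y⁺ w e = dec-true (w Fin.≟ v ⊎-dec Y w Bool.≟ true) (inj₂ e)

      Y⁺v : Y⁺ v ≡ true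
      Y⁺v = dec-true (v Fin.≟ v ⊎-dec Y v Bool.≟ true) (inj₁ refl)

      Y⁺-false : ∀ {w} → w ≢ v → Y w ≡ false → Y⁺ w ≡ false
      Y⁺-false {w} w≢v e = dec-false (w Fin.≟ v ⊎-dec Y w Bool.≟ true) λ where
        (inj₁ p) → w≢v p
        (inj₂ p) → true≢false p e

      E : Extension Y⁺
      E = extension Y⁺ (rec (Y⊆Y⁺ , v , Y⁺v , Yv)) (λ w d → Y⊆Y⁺ w (s⊆Y w d))
      open Extension E

      apart : ∀ {w} → Y w ≡ true → w ≢ v
      apart e refl = true≢false e Yv

      result : Extension Y
      result with s′ v in s′v
      -- Deeper stages colour `v` only as the tail of an arc, so it already has its false child.
      ... | just b = record
        { s′ = s′ ; good′ = good′ ; covers = covers′ ; defined = defined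
        ; not-false = λ w e → not-false w (Y⊆Y⁺ w e) }
        where
        covers′ : ∀ w → Y w ≡ false → s′ w ≢ nothing
        covers′ w e with w Fin.≟ v
        ... | yes refl = λ n → contradiction (trans (sym s′v) n) λ ()
        ... | no w≢v   = covers w (Y⁺-false w≢v e)
      ... | nothing = record
        { s′ = colour-arc s′ u v ; good′ = C.good good′ ; covers = covers′
        ; defined = λ w d → C.defined (defined w d)
        ; not-false = λ w e d → C.not-false (apart e) (not-false w (Y⊆Y⁺ w e) d) }
        where
        module C = ColourArc (apart Yu) a (not-false u (Y⊆Y⁺ u Yu) su) s′v
        covers′ : ∀ w → Y w ≡ false → colour-arc s′ u v w ≢ nothing
        covers′ w e with w Fin.≟ v
        ... | yes refl = λ ()
        ... | no w≢v with w Fin.≟ u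
        ...   | yes _ = λ ()
        ...   | no _  = covers w (Y⁺-false w≢v e)

    extend : V → GoodPartition D
    extend v₀ = good-total good′ total v₀
      where
      Y : V → Bool
      Y = is-just ∘ s

      s⊆Y : ∀ v → s v ≢ nothing → Y v ≡ true
      s⊆Y v d with s v
      ... | just _  = refl
      ... | nothing = contradiction refl d

      open Extension (extension Y (⊐-wellFounded Y) s⊆Y)

      total : ∀ v → s′ v ≢ nothing
      total v with s v in eq
      ... | just _  = defined v λ e → contradiction (trans (sym eq) e) λ ()
      ... | nothing = covers v (cong is-just eq)

  -- Cuts, ears and rings.

  -- Strong connectivity of the subdigraph induced by P, stated by cuts instead of paths.
  StrongIn : (V → Set) → Set
  StrongIn P = ∀ (Y : V → Bool) {u v} → P u → P v → Y u ≡ true → Y v ≡ false →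
    ∃[ u ] ∃[ v ] (P u × P v × Arc D u v × Y u ≡ true × Y v ≡ false)

  walk-crossing : ∀ (Y : V → Bool) {u v} → Walk D u v → Y u ≡ true → Y v ≡ false →
    ∃[ u ] ∃[ v ] (Arc D u v × Y u ≡ true × Y v ≡ false)
  walk-crossing Y (here u) Yu Yv = contradiction Yv (true≢false Yu)
  walk-crossing Y (step {u} {w} a p) Yu Yv with Y w in Yw
  ... | false = u , w , a , Yu , Yw
  ... | true  = walk-crossing Y p Yw Yv

  -- δ is the distance to the strong set H = δ⁻¹(0), and x k , … , x 1 the ear that leaves H
  -- by the arc h → x k and comes back by x 1 → x 0.
  record Ear (δ : V → ℕ) : Set where
    field
      k        : ℕ
      x        : ℕ → V
      h        : V
      0<k      : 0 < k
      δ-arc    : ∀ {u v} → Arc D u v → δ u ≤ suc (δ v)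
      δ-x      : ∀ {m} → m ≤ k → δ (x m) ≡ m
      δ-x≤k    : ∀ m → δ (x m) ≤ k
      rung-arc : ∀ {m} → m < k → Arc D (x (suc m)) (x m)
      δ-h      : δ h ≡ 0
      h-arc    : Arc D h (x k)
      shortest : ∀ {u v} → Arc D u v → δ u ≡ 0 → δ v ≢ 0 → k ≤ δ v
      strong   : StrongIn (λ v → δ v ≡ 0)

    -- Chords of the ear are left out, so that an interval of positive levels can be left only
    -- through its lowest vertex.
    data RingArc : V → V → Set where
      inner : ∀ {u v} → δ u ≡ 0 → δ v ≡ 0 → Arc D u v → RingArc u v
      entry : RingArc h (x k)
      rung  : ∀ {m} → m < k → RingArc (x (suc m)) (x m)

    ringArc⇒arc : ∀ {u v} → RingArc u v → Arc D u v
    ringArc⇒arc (inner _ _ a) = a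
    ringArc⇒arc entry         = h-arc
    ringArc⇒arc (rung m<k)    = rung-arc m<k

    -- The index of an ear vertex is its level, so membership is decidable without a search over
    -- indices.
    OnRing : V → Set
    OnRing v = δ v ≡ 0 ⊎ v ≡ x (δ v)

    onRing-x : ∀ {m} → m ≤ k → OnRing (x m)
    onRing-x m≤k = inj₂ (cong x (sym (δ-x m≤k)))

    onRing-level : ∀ {v} → OnRing v → δ v ≤ k
    onRing-level     (inj₁ e) = subst (_≤ k) (sym e) z≤n
    onRing-level {v} (inj₂ e) = subst (_≤ k) (cong δ (sym e)) (δ-x≤k (δ v))

    onRing-ends : ∀ {u v} → RingArc u v → OnRing u × OnRing v
    onRing-ends (inner e e′ _) = inj₁ e , inj₁ e′
    onRing-ends entry          = inj₁ δ-h , onRing-x ≤-refl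
    onRing-ends (rung m<k)     = onRing-x m<k , onRing-x (<⇒≤ m<k)

    RingCrossing : (V → Bool) → Set
    RingCrossing Y = ∃[ u ] ∃[ v ] (RingArc u v × Y u ≡ true × Y v ≡ false)

    -- On the way down from `x hi`, the first vertex outside `Y` is entered by a rung.
    descend : ∀ Y {lo hi} → lo ≤ hi → hi ≤ k → Y (x hi) ≡ true → Y (x lo) ≡ false → RingCrossing Y
    descend Y {lo} {hi} lo≤hi hi≤k Yhi Ylo with lo ≟ hi
    ... | yes refl = contradiction Ylo (true≢false Yhi)
    descend Y {zero} {zero} lo≤hi hi≤k Yhi Ylo | no lo≢hi = contradiction refl lo≢hi
    descend Y {lo} {suc hi} lo≤hi hi≤k Yhi Ylo | no lo≢hi with Y (x hi) in e
    ... | false = x (suc hi) , x hi , rung hi≤k , Yhi , e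
    ... | true  = descend Y (s≤s⁻¹ (≤∧≢⇒< lo≤hi lo≢hi)) (<⇒≤ hi≤k) e Ylo

    H-crossing : ∀ Y {u v} → δ u ≡ 0 → δ v ≡ 0 → Y u ≡ true → Y v ≡ false → RingCrossing Y
    H-crossing Y δu δv Yu Yv with strong Y δu δv Yu Yv
    ... | u′ , v′ , δu′ , δv′ , a , Yu′ , Yv′ = u′ , v′ , inner δu′ δv′ a , Yu′ , Yv′

    -- The route runs inside `H` to `h`, over the entry arc to `x k`, and down the ear to `v`; one
    -- of the three stretches leaves `Y`.
    crossing-from-H : ∀ Y {u v} → δ u ≡ 0 → OnRing v → Y u ≡ true → Y v ≡ false → RingCrossing Y
    crossing-from-H Y δu (inj₁ δv) Yu Yv = H-crossing Y δu δv Yu Yv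
    crossing-from-H Y {v = v} δu (inj₂ ev) Yu Yv with Y h in Yh
    ... | false = H-crossing Y δu δ-h Yu Yh
    ... | true with Y (x k) in Yk
    ...   | false = h , x k , entry , Yh , Yk
    ...   | true  = descend Y (onRing-level (inj₂ ev)) ≤-refl Yk (subst (λ w → Y w ≡ false) ev Yv)

    -- An ear vertex first descends to `x 0`, which lies in `H`.
    ring-crossing : ∀ Y {u v} → OnRing u → OnRing v → Y u ≡ true → Y v ≡ false → RingCrossing Y
    ring-crossing Y (inj₁ δu) Rv Yu Yv = crossing-from-H Y δu Rv Yu Yv
    ring-crossing Y (inj₂ eu) Rv Yu Yv with Y (x 0) in Y0
    ... | false = descend Y z≤n (onRing-level (inj₂ eu)) (subst (λ w → Y w ≡ true) eu Yu) Y0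
    ... | true  = crossing-from-H Y (δ-x z≤n) Rv Y0 Yv

    onRing-strong : StrongIn OnRing
    onRing-strong Y Ru Rv Yu Yv with ring-crossing Y Ru Rv Yu Yv
    ... | u , v , r , Yu′ , Yv′ =
      u , v , proj₁ (onRing-ends r) , proj₂ (onRing-ends r) , ringArc⇒arc r , Yu′ , Yv′

  -- Spanning ears.

  module _ {δ : V → ℕ} (ear : Ear δ) (spanning : ∀ v → Ear.OnRing ear v) where

    open Ear ear

    at-level : ∀ {v} → δ v ≢ 0 → v ≡ x (δ v)
    at-level {v} δv≢0 with spanning v
    ... | inj₁ e = contradiction e δv≢0
    ... | inj₂ e = e

    at-level-≡ : ∀ {v m} → m ≢ 0 → δ v ≡ m → v ≡ x m
    at-level-≡ m≢0 refl = at-level m≢0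

    δ≤k : ∀ v → δ v ≤ k
    δ≤k v = onRing-level (spanning v)

    -- A colouring of the levels lo , … , hi extends as soon as the last vertex x lo is true:
    -- the ring leaves the interval at x lo only.
    module Interval (lo hi : ℕ) (0<lo : 0 < lo) (lo≤hi : lo ≤ hi) (hi≤k : hi ≤ k)
        (σ : ℕ → Bool) (σ-lo : σ lo ≡ true)
        (out : ∀ j → lo ≤ j → j ≤ hi → σ j ≡ true →
               ∃[ i ] (lo ≤ i × i ≤ hi × σ i ≡ false × Arc D (x j) (x i)))
        (inn : ∀ j → lo ≤ j → j ≤ hi → σ j ≡ false →
               ∃[ i ] (lo ≤ i × i ≤ hi × σ i ≡ true × Arc D (x i) (x j))) where

      s : V → Maybe Bool
      s v with lo ≤? δ v ×-dec δ v ≤? hi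
      ... | yes _ = just (σ (δ v))
      ... | no  _ = nothing

      s-level : ∀ {v} → lo ≤ δ v → δ v ≤ hi → s v ≡ just (σ (δ v))
      s-level {v} p q with lo ≤? δ v ×-dec δ v ≤? hi
      ... | yes _ = refl
      ... | no ¬r = contradiction (p , q) ¬r

      s-x : ∀ {j} → lo ≤ j → j ≤ hi → s (x j) ≡ just (σ j)
      s-x {j} p q = trans (s-level (subst (lo ≤_) (sym e) p) (subst (_≤ hi) (sym e) q)) (cong (just ∘ σ) e)
        where
        e : δ (x j) ≡ j
        e = δ-x (≤-trans q hi≤k)

      s-inv : ∀ {v b} → s v ≡ just b → lo ≤ δ v × δ v ≤ hi × σ (δ v) ≡ b
      s-inv {v} e with lo ≤? δ v ×-dec δ v ≤? hi
      ... | yes (p , q) = p , q , just-injective e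

      here-x : ∀ {v} → lo ≤ δ v → v ≡ x (δ v)
      here-x p = at-level (>⇒≢ (<-≤-trans 0<lo p))

      good : Good s
      good = record { out = out′ ; inn = inn′ }
        where
        out′ : ∀ v → s v ≡ just true → ∃[ w ] (s w ≡ just false × Arc D v w)
        out′ v e with s-inv {v} e
        ... | p , q , σv with out (δ v) p q σv
        ...   | i , lo≤i , i≤hi , σi , a =
          x i , trans (s-x lo≤i i≤hi) (cong just σi) , subst (λ w → Arc D w (x i)) (sym (here-x p)) a

        inn′ : ∀ v → s v ≡ just false → ∃[ w ] (s w ≡ just true × Arc D w v)
        inn′ v e with s-inv {v} e
        ... | p , q , σv with inn (δ v) p q σv
        ...   | i , lo≤i , i≤hi , σi , a =
          x i , trans (s-x lo≤i i≤hi) (cong just σi) , subst (Arc D (x i)) (sym (here-x p)) a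

      defined : ∀ {j} → lo ≤ j → j ≤ hi → s (x j) ≢ nothing
      defined p q e with () ← trans (sym (s-x p q)) e

      escape : ∀ Y → (∀ v → s v ≢ nothing → Y v ≡ true) → ∀ v → Y v ≡ false → Escape s Y
      escape Y s⊆Y v Yv
        with ring-crossing Y (spanning (x lo)) (spanning v) (s⊆Y (x lo) (defined ≤-refl lo≤hi)) Yv
      ... | u , w , r , Yu , Yw = u , w , ringArc⇒arc r , Yu , Yw , λ e → leaves r Yw (s-inv {u} e)
        where
        leaves : ∀ {u w} → RingArc u w → Y w ≡ false → ¬ (lo ≤ δ u × δ u ≤ hi × σ (δ u) ≡ false)
        leaves (inner δu _ _) _ (p , _) = contradiction δu (>⇒≢ (<-≤-trans 0<lo p))
        leaves entry          _ (p , _) = contradiction δ-h (>⇒≢ (<-≤-trans 0<lo p))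
        leaves (rung {m} m<k) Yw (p , q , σu) rewrite δ-x m<k with lo ≤? m
        -- A rung within the interval has a coloured head, which lies in `Y`; the rung leaving the
        -- interval has the true tail `x lo`.
        ... | yes lo≤m = true≢false (s⊆Y (x m) (defined lo≤m (≤-trans (n≤1+n m) q))) Yw
        ... | no  lo≰m = true≢false σ-lo (subst (λ j → σ j ≡ false) (≤-antisym (≰⇒> lo≰m) p) σu)

      partition : GoodPartition D
      partition = extend good escape h

    -- Both ends of the ear are false: `x k` has the true in-neighbour `h`, and each true level lies
    -- directly above a false one. Only `H` without `h` stays uncoloured, and it is reached from `h`
    -- inside `H`.
    module OddEar (k-odd : odd k ≡ true) where

      s : V → Maybe Bool
      s v with v Fin.≟ h | δ v ≟ 0
      ... | yes _ | _     = just true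
      ... | no  _ | yes _ = nothing
      ... | no  _ | no  _ = just (not (odd (δ v)))

      s-h : s h ≡ just true
      s-h with h Fin.≟ h | δ h ≟ 0
      ... | yes _ | _ = refl
      ... | no ¬p | _ = contradiction refl ¬p

      s-level : ∀ {v} → δ v ≢ 0 → s v ≡ just (not (odd (δ v)))
      s-level {v} δv≢0 with v Fin.≟ h | δ v ≟ 0
      ... | yes refl | _     = contradiction δ-h δv≢0
      ... | no  _    | yes e = contradiction e δv≢0
      ... | no  _    | no  _ = refl

      s-x : ∀ {j} → j ≢ 0 → j ≤ k → s (x j) ≡ just (not (odd j))
      s-x {j} j≢0 j≤k = trans (s-level (λ e → j≢0 (trans (sym (δ-x j≤k)) e)))
        (cong (just ∘ not ∘ odd) (δ-x j≤k))

      good : Good s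
      good = record { out = out ; inn = inn }
        where
        out-even : ∀ {v} m → δ v ≡ m → m ≢ 0 → odd m ≡ false → ∃[ w ] (s w ≡ just false × Arc D v w)
        out-even zero          _  m≢0 _ = contradiction refl m≢0
        out-even {v} (suc (suc m)) δv _ e =
          x (suc m) ,
          trans (s-x (λ ()) (<⇒≤ m+1<k)) (cong just e) ,
          subst (λ w → Arc D w (x (suc m))) (sym (at-level-≡ (λ ()) δv)) (rung-arc m+1<k)
          where
          m+1<k : suc m < k
          m+1<k = subst (_≤ k) δv (δ≤k v)

        out : ∀ v → s v ≡ just true → ∃[ w ] (s w ≡ just false × Arc D v w)
        out v e with v Fin.≟ h | δ v ≟ 0
        ... | yes refl | _ = x k , trans (s-x (>⇒≢ 0<k) ≤-refl) (cong (just ∘ not) k-odd) , h-arc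
        ... | no _ | no δv≢0 = out-even (δ v) refl δv≢0 (not-injective (just-injective e))

        inn : ∀ v → s v ≡ just false → ∃[ w ] (s w ≡ just true × Arc D w v)
        inn v e with v Fin.≟ h | δ v ≟ 0
        ... | no _ | no δv≢0 with δ v ≟ k
        ...   | yes δv≡k = h , s-h , subst (Arc D h) (sym (at-level-≡ (>⇒≢ 0<k) δv≡k)) h-arc
        ...   | no δv≢k  =
          x (suc (δ v)) ,
          trans (s-x (λ ()) δv<k) (cong (just ∘ not) (just-injective e)) ,
          subst (Arc D (x (suc (δ v)))) (sym (at-level δv≢0)) (rung-arc δv<k)
          where
          δv<k : δ v < k
          δv<k = ≤∧≢⇒< (δ≤k v) δv≢k

      s-H : ∀ {v} → δ v ≡ 0 → s v ≢ just false
      s-H {v} e with v Fin.≟ h | δ v ≟ 0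
      ... | yes _ | _     = λ ()
      ... | no  _ | yes _ = λ ()
      ... | no  _ | no ¬p = contradiction e ¬p

      escape : ∀ Y → (∀ v → s v ≢ nothing → Y v ≡ true) → ∀ v → Y v ≡ false → Escape s Y
      escape Y s⊆Y v Yv with δ v ≟ 0
      ... | no δv≢0 = contradiction Yv
        (true≢false (s⊆Y v λ e → contradiction (trans (sym (s-level δv≢0)) e) λ ()))
      ... | yes δv with strong Y δ-h δv (s⊆Y h λ e → contradiction (trans (sym s-h) e) λ ()) Yv
      ...   | u , w , δu , _ , a , Yu , Yw = u , w , a , Yu , Yw , s-H δu

      partition : GoodPartition D
      partition = extend good escape h

    -- Rungs supply all witnesses except an out-neighbour for `x lo` and an in-neighbour for `x hi`;
    -- the closing upward arc supplies both.
    even-cycle : ∀ {lo hi} (τ : ℕ → Bool) → (∀ j → τ (suc j) ≡ not (τ j)) →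
      0 < lo → lo < hi → hi ≤ k → τ lo ≡ true → τ hi ≡ false → Arc D (x lo) (x hi) → GoodPartition D
    even-cycle {lo} {hi} τ alt 0<lo lo<hi hi≤k τlo τhi up =
      Interval.partition lo hi 0<lo (<⇒≤ lo<hi) hi≤k τ τlo out inn
      where
      out : ∀ j → lo ≤ j → j ≤ hi → τ j ≡ true →
            ∃[ i ] (lo ≤ i × i ≤ hi × τ i ≡ false × Arc D (x j) (x i))
      out j lo≤j j≤hi τj with lo ≟ j
      ... | yes refl = hi , <⇒≤ lo<hi , ≤-refl , τhi , up
      out zero    lo≤j j≤hi τj | no lo≢j = contradiction (n≤0⇒n≡0 lo≤j) lo≢j
      out (suc j) lo≤j j≤hi τj | no lo≢j =
        j , s≤s⁻¹ (≤∧≢⇒< lo≤j lo≢j) , <⇒≤ j≤hi ,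
        not-injective (trans (sym (alt j)) τj) , rung-arc (<-≤-trans j≤hi hi≤k)

      inn : ∀ j → lo ≤ j → j ≤ hi → τ j ≡ false →
            ∃[ i ] (lo ≤ i × i ≤ hi × τ i ≡ true × Arc D (x i) (x j))
      inn j lo≤j j≤hi τj with j ≟ hi
      ... | yes refl = lo , ≤-refl , <⇒≤ lo<hi , τlo , up
      ... | no j≢hi  =
        suc j , ≤-trans lo≤j (n≤1+n j) , j<hi , trans (alt j) (cong not τj) , rung-arc (<-≤-trans j<hi hi≤k)
        where
        j<hi : j < hi
        j<hi = ≤∧≢⇒< j≤hi j≢hi

    -- Ends of different parity close an even cycle; `odd` or its complement is taken so that the
    -- lower end is true.
    up-arc-parity : ∀ {lo hi} → 0 < lo → lo < hi → hi ≤ k → Arc D (x lo) (x hi) →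
      GoodPartition D ⊎ odd hi ≡ odd lo
    up-arc-parity {lo} {hi} 0<lo lo<hi hi≤k up with odd lo in olo | odd hi in ohi
    ... | true  | true  = inj₂ refl
    ... | false | false = inj₂ refl
    ... | true  | false = inj₁ (even-cycle odd (λ _ → refl) 0<lo lo<hi hi≤k olo ohi up)
    ... | false | true  =
      inj₁ (even-cycle (not ∘ odd) (λ _ → refl) 0<lo lo<hi hi≤k (cong not olo) (cong not ohi) up)

    -- On the levels from `a` to `d`, odd is true and even is false, with the colours of `c` and
    -- `suc c` swapped. After the swap each of the two upward arcs goes from true to false and
    -- serves both its ends; rungs serve every other level.
    crossing-up-arcs : ∀ {a c d} → odd a ≡ true → odd c ≡ false → odd d ≡ false →
      a < c → suc c < d → d ≤ k → Arc D (x a) (x (suc c)) → Arc D (x c) (x d) → GoodPartition D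
    crossing-up-arcs {a} {c} {d} oa oc od a<c c+1<d d≤k a→b c→d =
      Interval.partition a d (odd⇒0< a oa) (<⇒≤ a<d) d≤k σ σ-a out inn
      where
      odd⇒0< : ∀ m → odd m ≡ true → 0 < m
      odd⇒0< (suc _) _ = s≤s z≤n

      c<d : c < d
      c<d = <-trans (n<1+n c) c+1<d

      a<d : a < d
      a<d = <-trans a<c c<d

      σ : ℕ → Bool
      σ j with j ≟ c | j ≟ suc c
      ... | yes _ | _     = true
      ... | no  _ | yes _ = false
      ... | no  _ | no  _ = odd j

      σ-c : σ c ≡ true
      σ-c with c ≟ c | c ≟ suc c
      ... | yes _ | _ = refl
      ... | no ¬p | _ = contradiction refl ¬p

      σ-b : σ (suc c) ≡ false
      σ-b with suc c ≟ c | suc c ≟ suc c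
      ... | yes p | _     = contradiction p 1+n≢n
      ... | no _  | yes _ = refl
      ... | no _  | no ¬p = contradiction refl ¬p

      σ-odd : ∀ {j} → j ≢ c → j ≢ suc c → σ j ≡ odd j
      σ-odd {j} j≢c j≢b with j ≟ c | j ≟ suc c
      ... | yes p | _     = contradiction p j≢c
      ... | no _  | yes p = contradiction p j≢b
      ... | no _  | no _  = refl

      σ-a : σ a ≡ true
      σ-a = trans (σ-odd (<⇒≢ a<c) (<⇒≢ (<-trans a<c (n<1+n c)))) oa

      σ-d : σ d ≡ false
      σ-d = trans (σ-odd (>⇒≢ c<d) (>⇒≢ c+1<d)) od

      out : ∀ j → a ≤ j → j ≤ d → σ j ≡ true →
            ∃[ i ] (a ≤ i × i ≤ d × σ i ≡ false × Arc D (x j) (x i))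
      out j a≤j j≤d σj with j ≟ c | j ≟ suc c
      ... | yes refl | _ = d , <⇒≤ a<d , ≤-refl , σ-d , c→d
      ... | no j≢c | no j≢b with a ≟ j
      ...   | yes refl = suc c , <⇒≤ (<-trans a<c (n<1+n c)) , <⇒≤ c+1<d , σ-b , a→b
      out (suc j) a≤j j≤d σj | no j≢c | no j≢b | no a≢j =
        j , s≤s⁻¹ (≤∧≢⇒< a≤j a≢j) , <⇒≤ j≤d ,
        trans (σ-odd (λ e → j≢b (cong suc e)) j≢b′) (not-injective σj) , rung-arc (<-≤-trans j≤d d≤k)
        where
        j≢b′ : j ≢ suc c
        j≢b′ refl = true≢false σj (trans (Bool.not-involutive _) oc)

      inn : ∀ j → a ≤ j → j ≤ d → σ j ≡ false →
            ∃[ i ] (a ≤ i × i ≤ d × σ i ≡ true × Arc D (x i) (x j))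
      inn j a≤j j≤d σj with j ≟ c | j ≟ suc c
      ... | no j≢c | yes refl = a , ≤-refl , <⇒≤ a<d , σ-a , a→b
      ... | no j≢c | no j≢b with j ≟ d
      ...   | yes refl = c , <⇒≤ a<c , <⇒≤ c<d , σ-c , c→d
      ...   | no j≢d =
        suc j , ≤-trans a≤j (n≤1+n j) , j<d ,
        trans (σ-odd j+1≢c (λ e → j≢c (suc-injective e))) (cong not σj) , rung-arc (<-≤-trans j<d d≤k)
        where
        j<d : j < d
        j<d = ≤∧≢⇒< j≤d j≢d
        j+1≢c : suc j ≢ c
        j+1≢c refl = true≢false (cong not σj) oc

    -- Ears with an even number of vertices.

    module EvenEar (K : ℕ) (k≡ : k ≡ 2 * suc K) where

      UpFrom : ℕ → Set
      UpFrom t = ∃[ w ] (Arc D (x (2 + 2 * t)) w × 2 + 2 * t < δ w)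

      -- The bound `0 < δ w` puts the tail on the ear, where the parity of upward arcs is
      -- controlled.
      UpInto : ℕ → Set
      UpInto t = ∃[ w ] (Arc D w (x (1 + 2 * t)) × 0 < δ w × δ w < 1 + 2 * t)

      upFrom? : Decidable UpFrom
      upFrom? t = any? λ w → T? _ ×-dec 2 + 2 * t <? δ w

      upInto? : Decidable UpInto
      upInto? t = any? λ w → T? _ ×-dec 0 <? δ w ×-dec δ w <? 1 + 2 * t

      k≡2+ : k ≡ 2 + 2 * K
      k≡2+ = trans k≡ (*-suc 2 K)

      level≤k : ∀ {t} → t ≤ K → 2 + 2 * t ≤ k
      level≤k t≤K = subst (_ ≤_) (sym k≡2+) (+-monoʳ-≤ 2 (*-monoʳ-≤ 2 t≤K))

      -- Arcs drop by at most one level and there are no loops, so another out-neighbour of the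
      -- upper end would lie higher, and another in-neighbour of the lower end would lie lower.
      lonely : ∀ {t} → t ≤ K → ¬ UpFrom t → ¬ UpInto t → LonelyArc
      lonely {t} t≤K ¬from ¬into =
        x (2 + 2 * t) , x (1 + 2 * t) , a , outdeg≡1 a only-out , indeg≡1 a only-in
        where
        hi≤k : 2 + 2 * t ≤ k
        hi≤k = level≤k t≤K

        a : Arc D (x (2 + 2 * t)) (x (1 + 2 * t))
        a = rung-arc hi≤k

        δ-hi : δ (x (2 + 2 * t)) ≡ 2 + 2 * t
        δ-hi = δ-x hi≤k

        δ-lo : δ (x (1 + 2 * t)) ≡ 1 + 2 * t
        δ-lo = δ-x (<⇒≤ hi≤k)

        only-out : ∀ w → Arc D (x (2 + 2 * t)) w → w ≡ x (1 + 2 * t)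
        only-out w b = at-level-≡ (λ ()) (≤-antisym (s≤s⁻¹ (≤∧≢⇒< w≤hi w≢hi)) lo≤w)
          where
          lo≤w : 1 + 2 * t ≤ δ w
          lo≤w = s≤s⁻¹ (subst (_≤ suc (δ w)) δ-hi (δ-arc b))
          w≤hi : δ w ≤ 2 + 2 * t
          w≤hi = ≮⇒≥ λ p → ¬from (w , b , p)
          w≢hi : δ w ≢ 2 + 2 * t
          w≢hi e = no-loop (subst (Arc D _) (at-level-≡ (λ ()) e) b)

        only-in : ∀ w → Arc D w (x (1 + 2 * t)) → w ≡ x (2 + 2 * t)
        only-in w b = at-level-≡ (λ ()) (≤-antisym w≤hi (≤∧≢⇒< lo≤w (λ e → w≢lo (sym e))))
          where
          w≤hi : δ w ≤ 2 + 2 * t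
          w≤hi = subst (λ m → δ w ≤ suc m) δ-lo (δ-arc b)
          δw≢0 : δ w ≢ 0
          -- An arc out of `H` arrives at level `k` or above, but this level is below `k`.
          δw≢0 e = <⇒≱ hi≤k (subst (k ≤_) δ-lo (shortest b e λ z → contradiction (trans (sym δ-lo) z) λ ()))
          lo≤w : 1 + 2 * t ≤ δ w
          lo≤w = ≮⇒≥ λ p → ¬into (w , b , n≢0⇒n>0 δw≢0 , p)
          w≢lo : δ w ≢ 1 + 2 * t
          w≢lo e = no-loop (subst (λ z → Arc D z _) (at-level-≡ (λ ()) e) b)

      crossing : ∀ {t} → suc t ≤ K → UpFrom t → UpInto (suc t) → GoodPartition D
      crossing {t} t<K (w , c→w , c<w) (v , v→b , 0<v , v<b) rewrite *-suc 2 t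
        with up-arc-parity {2 + 2 * t} {δ w} (s≤s z≤n) c<w (δ≤k w) (subst (Arc D _) (at-level (>⇒≢ (<-trans (s≤s z≤n) c<w))) c→w)
           | up-arc-parity {δ v} {3 + 2 * t} 0<v v<b b≤k (subst (λ z → Arc D z _) (at-level (>⇒≢ 0<v)) v→b)
        where
        b≤k : 3 + 2 * t ≤ k
        b≤k = ≤-trans (n≤1+n _) (subst (λ m → 2 + m ≤ k) (*-suc 2 t) (level≤k t<K))
      ... | inj₁ g | _      = g
      ... | inj₂ _ | inj₁ g = g
      ... | inj₂ pw | inj₂ pv =
        crossing-up-arcs ov c-even ow
          -- Parity excludes equality in `δ v ≤ 2 + 2 * t` and in `3 + 2 * t ≤ δ w`.
          (≤∧≢⇒< (s≤s⁻¹ v<b) (λ e → true≢false ov (trans (cong odd e) c-even)))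
          (≤∧≢⇒< c<w (λ e → true≢false (cong not c-even) (trans (cong odd e) ow)))
          (δ≤k w)
          (subst (λ z → Arc D z _) (at-level (>⇒≢ 0<v)) v→b)
          (subst (Arc D _) (at-level (>⇒≢ (<-trans (s≤s z≤n) c<w))) c→w)
        where
        c-even : odd (2 + 2 * t) ≡ false
        c-even = trans (Bool.not-involutive _) (odd-2* t)
        ow : odd (δ w) ≡ false
        ow = trans pw c-even
        ov : odd (δ v) ≡ true
        ov = trans (sym pv) (cong not c-even)

      -- Downward search carrying an upward arc into level `1 + 2 * t`. At the next lower pair of
      -- levels, an upward arc out of its upper level crosses the carried one; otherwise an upward
      -- arc into its lower level continues the search, and with neither the rung is lonely. At
      -- `t = 0` no ear level is left for the tail.
      scan : ∀ t → t ≤ K → UpInto t → GoodPartition D ⊎ LonelyArc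
      scan zero    t≤K (v , _ , 0<v , v<1) = contradiction v<1 (≤⇒≯ 0<v)
      scan (suc t) t<K into with upFrom? t | upInto? t
      ... | yes from | _         = inj₁ (crossing t<K from into)
      ... | no _     | yes into′ = scan t (<⇒≤ t<K) into′
      ... | no ¬from | no ¬into  = inj₂ (lonely (<⇒≤ t<K) ¬from ¬into)

      conclusion : GoodPartition D ⊎ LonelyArc
      conclusion with upInto? K
      ... | yes into = scan K ≤-refl into
      ... | no ¬into = inj₂ (lonely ≤-refl ¬from ¬into)
        where
        ¬from : ¬ UpFrom K
        ¬from (w , _ , p) = <⇒≱ p (subst (δ w ≤_) k≡2+ (δ≤k w))

    spanning-ear : GoodPartition D ⊎ LonelyArc
    spanning-ear with odd k in ok
    ... | true = inj₁ (OddEar.partition ok)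
    ... | false with even⇒2* k ok
    ...   | zero  , k≡0 = contradiction k≡0 (>⇒≢ 0<k)
    ...   | suc K , k≡  = EvenEar.conclusion K k≡

  -- Distance to a vertex set.

  record DistanceTo (H : V → Bool) : Set where
    field
      δ         : V → ℕ
      H⇒δ≡0     : ∀ {v} → H v ≡ true → δ v ≡ 0
      δ≡0⇒H     : ∀ {v} → δ v ≡ 0 → H v ≡ true
      δ-arc     : ∀ {u v} → Arc D u v → δ u ≤ suc (δ v)
      -- Total, so that it can be iterated: at level 0 the level stays 0 and no arc is promised.
      step-down : ∀ v → ∃[ w ] (δ w ≡ pred (δ v) × (0 < δ v → Arc D v w))

  module Distance (H : V → Bool) where

    Reaches : ℕ → V → Set
    Reaches zero    v = H v ≡ true
    Reaches (suc m) v = ∃[ w ] (Arc D v w × Reaches m w)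

    reaches? : ∀ m → Decidable (Reaches m)
    reaches? zero    v = H v Bool.≟ true
    reaches? (suc m) v = any? λ w → T? _ ×-dec reaches? m w

    walk⇒reaches : ∀ {v w} → Walk D v w → H w ≡ true → ∃[ m ] Reaches m v
    walk⇒reaches (here _)   Hw = 0 , Hw
    walk⇒reaches (step a p) Hw with walk⇒reaches p Hw
    ... | m , q = suc m , _ , a , q

    distanceTo : ∀ {r} → H r ≡ true → (∀ v → Walk D v r) → DistanceTo H
    distanceTo {r} Hr walk = record
      { δ = δ
      ; H⇒δ≡0 = λ e → n≤0⇒n≡0 (δ-least e)
      ; δ≡0⇒H = λ {v} e → subst (λ m → Reaches m v) e (δ-reaches v)
      ; δ-arc = δ-arc
      ; step-down = λ v → step-down v (δ v) refl (δ-reaches v) }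
      where
      nearest : ∀ v → ∃[ m ] (Reaches m v × (∀ {j} → Reaches j v → m ≤ j))
      nearest v = let m , p = walk⇒reaches (walk v) Hr in least (λ m → reaches? m v) m p

      δ : V → ℕ
      δ v = proj₁ (nearest v)

      δ-reaches : ∀ v → Reaches (δ v) v
      δ-reaches v = proj₁ (proj₂ (nearest v))

      δ-least : ∀ {v m} → Reaches m v → δ v ≤ m
      δ-least {v} = proj₂ (proj₂ (nearest v))

      δ-arc : ∀ {u v} → Arc D u v → δ u ≤ suc (δ v)
      δ-arc {v = v} a = δ-least (v , a , δ-reaches v)

      step-down : ∀ v m → δ v ≡ m → Reaches m v → ∃[ w ] (δ w ≡ pred m × (0 < m → Arc D v w))
      step-down v zero    e _           = v , e , λ ()
      step-down v (suc m) e (w , a , p) =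
        w , ≤-antisym (δ-least p) (s≤s⁻¹ (subst (_≤ suc (δ w)) e (δ-arc a))) , λ _ → a

  -- Shortest ears and growth of the strong set.

  module _ {H : V → Bool} (dist : DistanceTo H) (H-strong : StrongIn (λ v → H v ≡ true)) where

    open DistanceTo dist

    Exit : ℕ → Set
    Exit m = ∃[ u ] ∃[ v ] (Arc D u v × H u ≡ true × H v ≡ false × δ v ≡ m)

    exit? : Decidable Exit
    exit? m = any? λ u → any? λ v →
      T? _ ×-dec H u Bool.≟ true ×-dec H v Bool.≟ false ×-dec δ v ≟ m

    -- The ear follows `step-down` from the head of an exit of least level; this minimality is the
    -- field `shortest`.
    earFromExit : ∀ {k} → Exit k → (∀ {j} → Exit j → k ≤ j) → Ear δ
    earFromExit {k} (h , p , a , Hh , Hp , δp) min = record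
      { k = k ; x = x ; h = h ; 0<k = n≢0⇒n>0 k≢0
      ; δ-arc = δ-arc
      ; δ-x = λ {m} m≤k → trans (δ-descent (k ∸ m)) (m∸[m∸n]≡n m≤k)
      ; δ-x≤k = λ m → subst (_≤ k) (sym (δ-descent (k ∸ m))) (m∸n≤m k (k ∸ m))
      ; rung-arc = rung
      ; δ-h = H⇒δ≡0 Hh
      ; h-arc = subst (λ j → Arc D h (descent j)) (sym (n∸n≡0 k)) a
      ; shortest = λ b δu δv → min (_ , _ , b , δ≡0⇒H δu , ¬-not (δv ∘ H⇒δ≡0) , refl)
      ; strong = strong }
      where
      descent : ℕ → V
      descent zero    = p
      descent (suc i) = proj₁ (step-down (descent i))

      x : ℕ → V
      -- Reversed so that index equals level; beyond `k`, truncated subtraction keeps the value `p`.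
      x m = descent (k ∸ m)

      k≢0 : k ≢ 0
      k≢0 e = true≢false (δ≡0⇒H (trans δp e)) Hp

      δ-descent : ∀ i → δ (descent i) ≡ k ∸ i
      δ-descent zero    = δp
      δ-descent (suc i) = trans (proj₁ (proj₂ (step-down (descent i))))
        (trans (cong pred (δ-descent i)) (pred[m∸n]≡m∸[1+n] k i))

      rung : ∀ {m} → m < k → Arc D (x (suc m)) (x m)
      rung {m} m<k = subst (λ j → Arc D (x (suc m)) (descent j)) (sym (+-∸-assoc 1 m<k))
        (proj₂ (proj₂ (step-down (x (suc m))))
          (subst (0 <_) (sym (trans (δ-descent (k ∸ suc m)) (m∸[m∸n]≡n m<k))) (s≤s z≤n)))

      strong : StrongIn (λ v → δ v ≡ 0)
      strong Y δu δv Yu Yv with H-strong Y (δ≡0⇒H δu) (δ≡0⇒H δv) Yu Yv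
      ... | u′ , v′ , Hu , Hv , b , Yu′ , Yv′ = u′ , v′ , H⇒δ≡0 Hu , H⇒δ≡0 Hv , b , Yu′ , Yv′

    nearest-ear : ∀ {r v} → Walk D r v → H r ≡ true → H v ≡ false → Ear δ
    nearest-ear p Hr Hv =
      let u , w , a , Hu , Hw = walk-crossing H p Hr Hv
          _ , exit , min      = least exit? (δ w) (u , w , a , Hu , Hw , refl)
      in earFromExit exit min

    module _ (ear : Ear δ) where

      open Ear ear

      onRing? : Decidable OnRing
      onRing? w = δ w ≟ 0 ⊎-dec w Fin.≟ x (δ w)

      ring : V → Bool
      ring w = does (onRing? w)

      ring-strong : StrongIn (λ w → ring w ≡ true)
      ring-strong Y {u} {w} Ru Rw Yu Yw =
        let u′ , w′ , Ru′ , Rw′ , rest =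
              onRing-strong Y (does-true (onRing? u) Ru) (does-true (onRing? w) Rw) Yu Yw
        in u′ , w′ , dec-true (onRing? u′) Ru′ , dec-true (onRing? w′) Rw′ , rest

      ring⊐H : ring ⊐ H
      ring⊐H = (λ w Hw → dec-true (onRing? w) (inj₁ (H⇒δ≡0 Hw))) ,
        x k , dec-true (onRing? (x k)) (onRing-x ≤-refl) ,
        ¬-not λ e → >⇒≢ 0<k (trans (sym (δ-x ≤-refl)) (H⇒δ≡0 e))

      finish-or-enlarge : (GoodPartition D ⊎ LonelyArc) ⊎
        ∃[ H⁺ ] (H⁺ ⊐ H × StrongIn (λ v → H⁺ v ≡ true) × ∃[ v ] H⁺ v ≡ false)
      finish-or-enlarge with any? (λ w → ring w Bool.≟ false)
      ... | yes outside = inj₂ (ring , ring⊐H , ring-strong , outside)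
      ... | no full     = inj₁ (spanning-ear ear λ w → does-true (onRing? w) (¬-not λ e → full (w , e)))

  grow : (∀ u v → Walk D u v) → ∀ H → Acc _⊐_ H → StrongIn (λ v → H v ≡ true) →
    ∀ {r v} → H r ≡ true → H v ≡ false → GoodPartition D ⊎ LonelyArc
  grow walk H (acc rec) H-strong {r} {v} Hr Hv
    with Distance.distanceTo H Hr (λ w → walk w r)
  ... | dist with finish-or-enlarge dist H-strong (nearest-ear dist H-strong (walk r v) Hr Hv)
  ...   | inj₁ done = done
  ...   | inj₂ (H⁺ , H⁺⊐H , H⁺-strong , w , H⁺w) =
    grow walk H⁺ (rec H⁺⊐H) H⁺-strong (proj₁ H⁺⊐H r Hr) H⁺w

  strong⇒walk : Strong D → ∀ u v → Walk D u v
  strong⇒walk D-strong u v with u Fin.≟ v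
  ... | yes refl = here u
  ... | no u≢v   = proj₁ (D-strong u v u≢v)

theorem5p5 : (D : Digraph) → n D ≥ 1 → Strong D →
    GoodPartition D
    ⊎ (n D ≡ 1
    ⊎ (∃[ x ] ∃[ y ] (Arc D x y × outdeg D x ≡ 1 × indeg D y ≡ 1)))
theorem5p5 record { n = suc zero } _ _ = inj₂ (inj₁ refl)
theorem5p5 D@record { n = suc (suc _) } _ D-strong =
  map₂ inj₂ (grow D (strong⇒walk D D-strong) H (⊐-wellFounded H) H-strong {zero} {suc zero} refl refl)
  where
  -- A single vertex is trivially strong and starts the growth; `suc zero` lies outside.
  H : Vertex D → Bool
  H v = does (v Fin.≟ zero)

  H-strong : StrongIn D (λ v → H v ≡ true)
  H-strong Y {zero} {zero} _ _ Yu Yv = contradiction Yv (true≢false Yu)
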